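{- For every positive integer $k$ and $n=18k+3$, $G(n)=6k$; that is, there exists a Steiner triple system on $18k+3$ points containing a cross-free set of size $6k$, and no Steiner triple system on $18k+3$ points contains a cross-free set of size $6k+1$.
   Context: A Steiner triple system STS$(n)$ is a pair $(V,\mathcal{B})$ with $|V|=n$ and $\mathcal{B}$ a family of $3$-element subsets (blocks) of $V$ such that every pair of distinct points lies in exactly one block. A cross-free set of size $m$ in $(V,\mathcal{B})$ is a triple of pairwise disjoint $m$-element subsets $X_1,X_2,X_3\subset V$ such that no block intersects each $X_i$ in exactly one point. $G(n)$ denotes the largest size of a cross-free set present in some STS$(n)$. -}

module Defs where

open import Data.Nat using (ℕ; suc)
open import Data.Fin using (Fin)
open import Data.Fin.Subset using (Subset; _∈_; _∩_; ∣_∣; Empty)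
open import Data.Product using (Σ; _×_)
open import Relation.Binary.PropositionalEquality using (_≡_)
open import Relation.Nullary using (¬_)


record IsSTS (n : ℕ) (𝓑 : Subset n → Set) : Set₁ where
  field
    block-size : ∀ B → 𝓑 B → ∣ B ∣ ≡ 3
    pair-covered : ∀ (x y : Fin n) → ¬ (x ≡ y) →
      Σ (Subset n) (λ B → 𝓑 B × (x ∈ B) × (y ∈ B))
    pair-unique : ∀ (x y : Fin n) → ¬ (x ≡ y) → ∀ B B′ →
      𝓑 B → x ∈ B → y ∈ B → 𝓑 B′ → x ∈ B′ → y ∈ B′ → B ≡ B′

record IsCrossFree (n : ℕ) (𝓑 : Subset n → Set) (m : ℕ)
                   (X₁ X₂ X₃ : Subset n) : Set where
  field
    size₁ : ∣ X₁ ∣ ≡ m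
    size₂ : ∣ X₂ ∣ ≡ m
    size₃ : ∣ X₃ ∣ ≡ m
    disj₁₂ : Empty (X₁ ∩ X₂)
    disj₁₃ : Empty (X₁ ∩ X₃)
    disj₂₃ : Empty (X₂ ∩ X₃)
    no-cross : ∀ B → 𝓑 B →
      ¬ ((∣ B ∩ X₁ ∣ ≡ 1) × (∣ B ∩ X₂ ∣ ≡ 1) × (∣ B ∩ X₃ ∣ ≡ 1))

HasCrossFree : (n : ℕ) → (Subset n → Set) → ℕ → Set
HasCrossFree n 𝓑 m =
  Σ (Subset n) λ X₁ → Σ (Subset n) λ X₂ → Σ (Subset n) λ X₃ →
    IsCrossFree n 𝓑 m X₁ X₂ X₃

{-# OPTIONS --safe #-}
-- Upper bound: a cross-free set of size m = n/3 partitions V, so every block through a point of X₁ and a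
-- point of X₂ has its third point in X₁ ∪ X₂ and contains exactly two of the m² pairs in X₁ × X₂. Hence m is
-- even, while 6k + 1 is odd.
--
-- Construction: take three layers, each a copy of a commutative quasigroup Q of order 6k, and points ∞₀, ∞₁,
-- ∞₂. The triples {(j , x) , (j , y) , (j + 1 , x · y)} come from a totally symmetric product on the layers,
-- and none of them meets all three layers. The product is not idempotent, so each {v , v ∙ v} is degenerate.
-- With Q chosen suitably, the pairs {v , v ∙ v} and the sides of k further triples
-- {(j , A i) , (j , B i) , (j + 1 , E i)} for each j form a cubic graph with a proper 3-edge-colouring. Those
-- triples are dropped, and ∞_c is joined to the edges of colour c.
module Submission where

open import Defs
open import Data.Nat using (ℕ; suc; _+_; _*_; _≤_)
open import Data.Fin.Subset using (Subset)
open import Data.Product using (Σ; _×_)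
open import Relation.Nullary using (¬_)
open import Data.Bool using (Bool; true; false)
open import Data.Fin using (Fin; zero; suc; _<?_; toℕ; combine; remQuot; cast)
open import Data.Fin.Patterns using (0F; 1F; 2F)
open import Data.Fin.Permutation using (permutation; ↔⇒≡)
open import Data.Fin.Properties using (_≟_; *↔×; +↔⊎; <-cmp; <-asym; suc-injective; toℕ-injective; toℕ-fromℕ<; toℕ<n; toℕ-combine; remQuot-combine; combine-remQuot; toℕ-cast; cast-is-id; cast-trans; all?; any?)
open import Data.Fin.Subset using (inside; outside; _∈_; _∉_; _∩_; _∪_; ∣_∣; Empty; Nonempty; ⁅_⁆)
open import Data.Fin.Subset.Properties using (_∈?_; ∈⊤; x∈p∪q⁻; x∈p∪q⁺; x∈p∩q⁻; x∈p∩q⁺; x∈⁅x⁆; x∈⁅y⁆⇒x≡y; ∣⁅x⁆∣≡1; ∣p∣≡n⇒p≡⊤; p⊆q⇒∣p∣≤∣q∣; ⊆-antisym)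
open import Data.Nat using (zero; _∸_; NonZero)
open import Data.Nat.Divisibility using (_∣_; divides; ∣m+n∣m⇒∣n; ∣⇒≤; ∣m⇒∣m*n)
open import Data.Nat.DivMod using (_%_; _mod_; m%n<n; m<n⇒m%n≡m; %-distribˡ-+; m%n%n≡m%n; [m+n]%n≡m%n; [m+kn]%n≡m%n)
open import Data.Nat.Primality using (prime[2]; euclidsLemma)
open import Data.Nat.Properties using (+-0-commutativeMonoid; +-comm; +-assoc; +-identityʳ; +-suc; *-comm; m*n≢0; m+[n∸m]≡n; <⇒≤; 1+n≰n)
open import Data.Nat.Tactic.RingSolver using (solve-∀)
open import Data.Product using (∃; ∃₂; _,_; proj₁; proj₂; swap)
open import Data.Product.Function.NonDependent.Propositional using (_×-↔_)
open import Data.Product.Properties using () renaming (≡-dec to ×-≡-dec)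
open import Data.Sum using (_⊎_; inj₁; inj₂; [_,_]′; reduce)
open import Data.Sum.Function.Propositional using (_⊎-↔_)
open import Data.Sum.Properties using (inj₁-injective)
open import Data.Vec using ([]; _∷_; here; there; tabulate)
open import Data.Vec.Properties using (lookup∘tabulate; []=⇒lookup; lookup⇒[]=)
open import Function using (_∘_; _↔_; Inverse; Injective; mk↔ₛ′)
open import Function.Properties.Inverse using (↔-refl; ↔-sym; ↔-trans)
open import Relation.Binary using (DecidableEquality; tri<; tri≈; tri>)
open import Relation.Binary.PropositionalEquality using (_≡_; _≢_; refl; sym; trans; cong; cong₂; subst; subst₂; module ≡-Reasoning)
open import Relation.Nullary using (¬?; yes; no; contradiction; does; _→-dec_)
open import Relation.Nullary.Decidable using (from-yes; dec-true)

open import Algebra.Properties.CommutativeMonoid.Sum +-0-commutativeMonoid using (sum; sum-cong-≗; sum-permute; ∑-distrib-+)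

private
  variable
    n m : ℕ

-- Parity of a finite set from involutions and perfect matchings

sum-const-1 : ∀ n → sum {n} (λ _ → 1) ≡ n
sum-const-1 zero = refl
sum-const-1 (suc n) = cong suc (sum-const-1 n)

-- The involution exchanges the points i < f i with the points f i < i.
fixedPointFree-involution⇒even : (f : Fin n → Fin n) → (∀ i → f (f i) ≡ i) → (∀ i → f i ≢ i) → 2 ∣ n
fixedPointFree-involution⇒even {n} f invol f≢ = divides (sum up) (begin
  n                                ≡⟨ sum-const-1 n ⟨
  sum {n} (λ _ → 1)                ≡⟨ sum-cong-≗ split ⟩
  sum (λ i → up i + up (f i))      ≡⟨ ∑-distrib-+ up (up ∘ f) ⟩
  sum up + sum (up ∘ f)            ≡⟨ cong (sum up +_) (sum-permute up (permutation f f invol invol)) ⟨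
  sum up + sum up                  ≡⟨ cong (sum up +_) (+-identityʳ (sum up)) ⟨
  2 * sum up                       ≡⟨ *-comm 2 (sum up) ⟩
  sum up * 2                       ∎)
  where
  open ≡-Reasoning

  less : (i j : Fin n) → ℕ
  less i j with i <? j
  ... | yes _ = 1
  ... | no  _ = 0

  up : Fin n → ℕ
  up i = less i (f i)

  less-tri : ∀ i j → j ≢ i → 1 ≡ less i j + less j i
  less-tri i j j≢i with i <? j | j <? i
  ... | yes _   | no  _   = refl
  ... | no  _   | yes _   = refl
  ... | yes i<j | yes j<i = contradiction j<i (<-asym i<j)
  ... | no  i≮j | no  j≮i with <-cmp i j
  ...   | tri< i<j _ _ = contradiction i<j i≮j
  ...   | tri≈ _ i≡j _ = contradiction (sym i≡j) j≢i
  ...   | tri> _ _ j<i = contradiction j<i j≮i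

  split : ∀ i → 1 ≡ up i + up (f i)
  split i = trans (less-tri i (f i) (f≢ i)) (cong (λ j → up i + less (f i) j) (sym (invol i)))

-- Passing to the mate is an involution because `R` is symmetric and functional; irreflexivity rules
-- out fixed points.
perfectMatching⇒even : ∀ {A : Set} → Fin n ↔ A → (R : A → A → Set) →
  (∀ {a b} → R a b → R b a) → (∀ {a b c} → R a b → R a c → b ≡ c) → (∀ {a} → ¬ R a a) →
  (∀ a → ∃ (R a)) → 2 ∣ n
perfectMatching⇒even {n} {A} bij R R-sym R-functional R-irrefl mate =
  fixedPointFree-involution⇒even f f-invol f≢
  where
  open Inverse bij

  f : Fin n → Fin n
  f i = from (proj₁ (mate (to i)))

  f-matched : ∀ i → R (to i) (to (f i))
  f-matched i = subst (R (to i)) (sym (strictlyInverseˡ _)) (proj₂ (mate (to i)))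

  f-invol : ∀ i → f (f i) ≡ i
  f-invol i = trans (sym (strictlyInverseʳ _))
    (trans (cong from (R-functional (f-matched (f i)) (R-sym (f-matched i)))) (strictlyInverseʳ i))

  f≢ : ∀ i → f i ≢ i
  f≢ i fi≡i = R-irrefl (subst (λ j → R (to i) (to j)) fi≡i (f-matched i))

-- Finite subsets: enumeration, sizes and three-element sets

enum : (p : Subset n) → Fin ∣ p ∣ → Fin n
enum (inside  ∷ p) zero    = zero
enum (inside  ∷ p) (suc i) = suc (enum p i)
enum (outside ∷ p) i       = suc (enum p i)

enum-∈ : (p : Subset n) (i : Fin ∣ p ∣) → enum p i ∈ p
enum-∈ (inside  ∷ p) zero    = here
enum-∈ (inside  ∷ p) (suc i) = there (enum-∈ p i)
enum-∈ (outside ∷ p) i       = there (enum-∈ p i)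

enum-injective : (p : Subset n) → Injective _≡_ _≡_ (enum p)
enum-injective (inside  ∷ p) {zero}  {zero}  eq = refl
enum-injective (inside  ∷ p) {suc i} {suc j} eq = cong suc (enum-injective p (suc-injective eq))
enum-injective (outside ∷ p) eq = enum-injective p (suc-injective eq)

rank : {p : Subset n} {x : Fin n} → x ∈ p → Fin ∣ p ∣
rank {p = inside  ∷ p} here        = zero
rank {p = inside  ∷ p} (there x∈p) = suc (rank x∈p)
rank {p = outside ∷ p} (there x∈p) = rank x∈p

enum-rank : {p : Subset n} {x : Fin n} (x∈p : x ∈ p) → enum p (rank x∈p) ≡ x
enum-rank {p = inside  ∷ p} here        = refl
enum-rank {p = inside  ∷ p} (there x∈p) = cong suc (enum-rank x∈p)
enum-rank {p = outside ∷ p} (there x∈p) = cong suc (enum-rank x∈p)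

∣p∪q∣≡∣p∣+∣q∣ : (p q : Subset n) → Empty (p ∩ q) → ∣ p ∪ q ∣ ≡ ∣ p ∣ + ∣ q ∣
∣p∪q∣≡∣p∣+∣q∣ []            []            _  = refl
∣p∪q∣≡∣p∣+∣q∣ (outside ∷ p) (outside ∷ q) ∅  = ∣p∪q∣≡∣p∣+∣q∣ p q (λ (x , x∈) → ∅ (suc x , there x∈))
∣p∪q∣≡∣p∣+∣q∣ (inside  ∷ p) (outside ∷ q) ∅  = cong suc (∣p∪q∣≡∣p∣+∣q∣ p q (λ (x , x∈) → ∅ (suc x , there x∈)))
∣p∪q∣≡∣p∣+∣q∣ (outside ∷ p) (inside  ∷ q) ∅  =
  trans (cong suc (∣p∪q∣≡∣p∣+∣q∣ p q (λ (x , x∈) → ∅ (suc x , there x∈)))) (sym (+-suc ∣ p ∣ ∣ q ∣))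
∣p∪q∣≡∣p∣+∣q∣ (inside  ∷ p) (inside  ∷ q) ∅  = contradiction (zero , here) ∅

∣p∣≡3⇒third : (p : Subset n) → ∣ p ∣ ≡ 3 → ∀ {x y} → x ∈ p → y ∈ p → x ≢ y →
  ∃ λ z → z ∈ p × z ≢ x × z ≢ y
∣p∣≡3⇒third p ∣p∣≡3 x∈p y∈p x≢y =
  let (c , c≢a , c≢b) = other ∣p∣≡3 (rank x∈p) (rank y∈p)
  in enum p c , enum-∈ p c
   , (λ eq → c≢a (enum-injective p (trans eq (sym (enum-rank x∈p)))))
   , (λ eq → c≢b (enum-injective p (trans eq (sym (enum-rank y∈p)))))
  where
  -- The size is a variable `m` here because an equation on `∣ p ∣` itself cannot be matched against
  -- `refl`.
  other : m ≡ 3 → (a b : Fin m) → ∃ λ c → c ≢ a × c ≢ b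
  other refl 0F 0F = 1F , (λ ()) , (λ ())
  other refl 0F 1F = 2F , (λ ()) , (λ ())
  other refl 0F 2F = 1F , (λ ()) , (λ ())
  other refl 1F 0F = 2F , (λ ()) , (λ ())
  other refl 1F 1F = 0F , (λ ()) , (λ ())
  other refl 1F 2F = 0F , (λ ()) , (λ ())
  other refl 2F 0F = 1F , (λ ()) , (λ ())
  other refl 2F 1F = 0F , (λ ()) , (λ ())
  other refl 2F 2F = 0F , (λ ()) , (λ ())

triple : (x y z : Fin n) → Subset n
triple x y z = ⁅ x ⁆ ∪ (⁅ y ⁆ ∪ ⁅ z ⁆)

∈-triple⁻ : ∀ {x y z w : Fin n} → w ∈ triple x y z → w ≡ x ⊎ w ≡ y ⊎ w ≡ z
∈-triple⁻ {x = x} {y} {z} w∈ with x∈p∪q⁻ ⁅ x ⁆ _ w∈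
... | inj₁ w∈x = inj₁ (x∈⁅y⁆⇒x≡y x w∈x)
... | inj₂ w∈yz with x∈p∪q⁻ ⁅ y ⁆ _ w∈yz
...   | inj₁ w∈y = inj₂ (inj₁ (x∈⁅y⁆⇒x≡y y w∈y))
...   | inj₂ w∈z = inj₂ (inj₂ (x∈⁅y⁆⇒x≡y z w∈z))

∈-triple⁺ : ∀ {x y z w : Fin n} → w ≡ x ⊎ w ≡ y ⊎ w ≡ z → w ∈ triple x y z
∈-triple⁺ (inj₁ refl)        = x∈p∪q⁺ (inj₁ (x∈⁅x⁆ _))
∈-triple⁺ (inj₂ (inj₁ refl)) = x∈p∪q⁺ (inj₂ (x∈p∪q⁺ (inj₁ (x∈⁅x⁆ _))))
∈-triple⁺ (inj₂ (inj₂ refl)) = x∈p∪q⁺ (inj₂ (x∈p∪q⁺ (inj₂ (x∈⁅x⁆ _))))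

∣⁅x⁆∪p∣≡1+∣p∣ : ∀ (x : Fin n) p → x ∉ p → ∣ ⁅ x ⁆ ∪ p ∣ ≡ suc ∣ p ∣
∣⁅x⁆∪p∣≡1+∣p∣ x p x∉p = trans
  (∣p∪q∣≡∣p∣+∣q∣ ⁅ x ⁆ p λ (y , y∈) →
    let (y∈x , y∈p) = x∈p∩q⁻ ⁅ x ⁆ p y∈ in x∉p (subst (_∈ p) (x∈⁅y⁆⇒x≡y x y∈x) y∈p))
  (cong (_+ ∣ p ∣) (∣⁅x⁆∣≡1 x))

∣triple∣≡3 : ∀ {x y z : Fin n} → x ≢ y → x ≢ z → y ≢ z → ∣ triple x y z ∣ ≡ 3
∣triple∣≡3 {x = x} {y} {z} x≢y x≢z y≢z = trans
  (∣⁅x⁆∪p∣≡1+∣p∣ x _ λ x∈yz → [ x≢y ∘ x∈⁅y⁆⇒x≡y y , x≢z ∘ x∈⁅y⁆⇒x≡y z ]′ (x∈p∪q⁻ ⁅ y ⁆ _ x∈yz))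
  (cong suc (trans (∣⁅x⁆∪p∣≡1+∣p∣ y _ (y≢z ∘ x∈⁅y⁆⇒x≡y z)) (cong suc (∣⁅x⁆∣≡1 z))))

-- An element `w` outside the triple would give a four-element subset of `p`.
∣p∣≡3⇒p⊆triple : (p : Subset n) → ∣ p ∣ ≡ 3 → ∀ {x y z} → x ∈ p → y ∈ p → z ∈ p →
  x ≢ y → x ≢ z → y ≢ z → ∀ {w} → w ∈ p → w ≡ x ⊎ w ≡ y ⊎ w ≡ z
∣p∣≡3⇒p⊆triple p ∣p∣≡3 {x} {y} {z} x∈p y∈p z∈p x≢y x≢z y≢z {w} w∈p with w ∈? triple x y z
... | yes w∈t = ∈-triple⁻ w∈t
... | no  w∉t = contradiction (subst₂ _≤_ ∣wt∣≡4 ∣p∣≡3 (p⊆q⇒∣p∣≤∣q∣ wt⊆p)) 1+n≰n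
  where
  ∣wt∣≡4 : ∣ ⁅ w ⁆ ∪ triple x y z ∣ ≡ 4
  ∣wt∣≡4 = trans (∣⁅x⁆∪p∣≡1+∣p∣ w _ w∉t) (cong suc (∣triple∣≡3 x≢y x≢z y≢z))

  wt⊆p : ∀ {v} → v ∈ ⁅ w ⁆ ∪ triple x y z → v ∈ p
  wt⊆p v∈ with x∈p∪q⁻ ⁅ w ⁆ _ v∈
  ... | inj₁ v∈w = subst (_∈ p) (sym (x∈⁅y⁆⇒x≡y w v∈w)) w∈p
  ... | inj₂ v∈t with ∈-triple⁻ v∈t
  ...   | inj₁ refl        = x∈p
  ...   | inj₂ (inj₁ refl) = y∈p
  ...   | inj₂ (inj₂ refl) = z∈p

-- Upper bound: the parts of a cross-free partition have even size

module _ {𝓑 : Subset n → Set} (sts : IsSTS n 𝓑) where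
  open IsSTS sts

  -- Each pair (x , y) ∈ X₁ × X₂ is matched with the other cross pair in the block through x and y.
  crossFree-partition⇒even : n ≡ m + (m + m) → HasCrossFree n 𝓑 m → 2 ∣ m
  crossFree-partition⇒even {m} n≡3m (X₁ , X₂ , X₃ , crossFree) =
    -- The matching shows that the number `m * m` of cross pairs is even, and 2 is prime.
    reduce (euclidsLemma m m prime[2]
      (subst₂ (λ a b → 2 ∣ a * b) size₁ size₂
        (perfectMatching⇒even *↔× R R-sym R-functional R-irrefl mate)))
    where
    open IsCrossFree crossFree

    X = X₁ ∪ (X₂ ∪ X₃)

    ∣X∣≡n : ∣ X ∣ ≡ n
    ∣X∣≡n = trans (∣p∪q∣≡∣p∣+∣q∣ X₁ _ disj₁) (trans
      (cong₂ _+_ size₁ (trans (∣p∪q∣≡∣p∣+∣q∣ X₂ X₃ disj₂₃) (cong₂ _+_ size₂ size₃))) (sym n≡3m))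
      where
      disj₁ : Empty (X₁ ∩ (X₂ ∪ X₃))
      disj₁ (x , x∈) with x∈p∩q⁻ X₁ _ x∈
      ... | x∈₁ , x∈₂₃ with x∈p∪q⁻ X₂ _ x∈₂₃
      ...   | inj₁ x∈₂ = disj₁₂ (x , x∈p∩q⁺ (x∈₁ , x∈₂))
      ...   | inj₂ x∈₃ = disj₁₃ (x , x∈p∩q⁺ (x∈₁ , x∈₃))

    -- The disjoint union of the three sets has `n` elements, so it is the full set.
    cover : ∀ x → x ∈ X₁ ⊎ x ∈ X₂ ⊎ x ∈ X₃
    cover x with x∈p∪q⁻ X₁ _ (subst (x ∈_) (sym (∣p∣≡n⇒p≡⊤ ∣X∣≡n)) ∈⊤)
    ... | inj₁ x∈₁  = inj₁ x∈₁
    ... | inj₂ x∈₂₃ = inj₂ (x∈p∪q⁻ X₂ _ x∈₂₃)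

    disjoint : ∀ {p q : Subset n} → Empty (p ∩ q) → ∀ {x y} → x ∈ p → y ∈ q → x ≢ y
    disjoint ∅ x∈p y∈q refl = ∅ (_ , x∈p∩q⁺ (x∈p , y∈q))

    -- `no-cross` speaks of sizes. The three points are distinct and exhaust the block, so by
    -- disjointness each intersection is a singleton.
    no-transversal : ∀ {B x y z} → 𝓑 B → x ∈ B → y ∈ B → z ∈ B → ¬ (x ∈ X₁ × y ∈ X₂ × z ∈ X₃)
    no-transversal {B} {x} {y} {z} 𝓑B x∈B y∈B z∈B (x∈₁ , y∈₂ , z∈₃) =
      no-cross B 𝓑B (single x∈B x∈₁ only₁ , single y∈B y∈₂ only₂ , single z∈B z∈₃ only₃)
      where
      single : ∀ {v Y} → v ∈ B → v ∈ Y → (∀ {w} → w ∈ B → w ∈ Y → w ≡ v) → ∣ B ∩ Y ∣ ≡ 1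
      single {v} {Y} v∈B v∈Y only = trans (cong ∣_∣ (⊆-antisym B∩Y⊆v v⊆B∩Y)) (∣⁅x⁆∣≡1 v)
        where
        B∩Y⊆v : ∀ {w} → w ∈ B ∩ Y → w ∈ ⁅ v ⁆
        B∩Y⊆v w∈ = let (w∈B , w∈Y) = x∈p∩q⁻ B Y w∈ in subst (_∈ ⁅ v ⁆) (sym (only w∈B w∈Y)) (x∈⁅x⁆ v)
        v⊆B∩Y : ∀ {w} → w ∈ ⁅ v ⁆ → w ∈ B ∩ Y
        v⊆B∩Y w∈v = subst (_∈ B ∩ Y) (sym (x∈⁅y⁆⇒x≡y v w∈v)) (x∈p∩q⁺ (v∈B , v∈Y))

      members : ∀ {w} → w ∈ B → w ≡ x ⊎ w ≡ y ⊎ w ≡ z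
      members = ∣p∣≡3⇒p⊆triple B (block-size B 𝓑B) x∈B y∈B z∈B
        (disjoint disj₁₂ x∈₁ y∈₂) (disjoint disj₁₃ x∈₁ z∈₃) (disjoint disj₂₃ y∈₂ z∈₃)

      only₁ : ∀ {w} → w ∈ B → w ∈ X₁ → w ≡ x
      only₁ w∈B w∈₁ with members w∈B
      ... | inj₁ w≡x        = w≡x
      ... | inj₂ (inj₁ w≡y) = contradiction w≡y (disjoint disj₁₂ w∈₁ y∈₂)
      ... | inj₂ (inj₂ w≡z) = contradiction w≡z (disjoint disj₁₃ w∈₁ z∈₃)

      only₂ : ∀ {w} → w ∈ B → w ∈ X₂ → w ≡ y
      only₂ w∈B w∈₂ with members w∈B
      ... | inj₁ w≡x        = contradiction (sym w≡x) (disjoint disj₁₂ x∈₁ w∈₂)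
      ... | inj₂ (inj₁ w≡y) = w≡y
      ... | inj₂ (inj₂ w≡z) = contradiction w≡z (disjoint disj₂₃ w∈₂ z∈₃)

      only₃ : ∀ {w} → w ∈ B → w ∈ X₃ → w ≡ z
      only₃ w∈B w∈₃ with members w∈B
      ... | inj₁ w≡x        = contradiction (sym w≡x) (disjoint disj₁₃ x∈₁ w∈₃)
      ... | inj₂ (inj₁ w≡y) = contradiction (sym w≡y) (disjoint disj₂₃ y∈₂ w∈₃)
      ... | inj₂ (inj₂ w≡z) = w≡z

    -- Pairs of ranks rather than of points, so that `*↔×` counts them.
    Pair : Set
    Pair = Fin ∣ X₁ ∣ × Fin ∣ X₂ ∣

    pt₁ : Pair → Fin n
    pt₁ (i , _) = enum X₁ i

    pt₂ : Pair → Fin n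
    pt₂ (_ , j) = enum X₂ j

    pt₁≢pt₂ : ∀ a b → pt₁ a ≢ pt₂ b
    pt₁≢pt₂ a b = disjoint disj₁₂ (enum-∈ X₁ _) (enum-∈ X₂ _)

    -- The third point of a block through a cross pair lies in `X₁` or `X₂`, so the block holds one
    -- more cross pair, obtained by changing one coordinate. `share` records which coordinate
    -- changes.
    record R (a b : Pair) : Set where
      field
        block : Subset n
        isBlock : 𝓑 block
        ∈₁ : pt₁ a ∈ block
        ∈₂ : pt₂ a ∈ block
        ∈₁′ : pt₁ b ∈ block
        ∈₂′ : pt₂ b ∈ block
        share : (pt₁ a ≢ pt₁ b × pt₂ a ≡ pt₂ b) ⊎ (pt₁ a ≡ pt₁ b × pt₂ a ≢ pt₂ b)

    R-sym : ∀ {a b} → R a b → R b a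
    R-sym r = record
      { block = block ; isBlock = isBlock ; ∈₁ = ∈₁′ ; ∈₂ = ∈₂′ ; ∈₁′ = ∈₁ ; ∈₂′ = ∈₂
      ; share = [ (λ (p , q) → inj₁ (p ∘ sym , sym q)) , (λ (p , q) → inj₂ (sym p , q ∘ sym)) ]′ share }
      where open R r

    R-irrefl : ∀ {a} → ¬ R a a
    R-irrefl r = [ (λ (p , _) → p refl) , (λ (_ , q) → q refl) ]′ (R.share r)

    Pair-≡ : ∀ {a b : Pair} → pt₁ a ≡ pt₁ b → pt₂ a ≡ pt₂ b → a ≡ b
    Pair-≡ eq₁ eq₂ = cong₂ _,_ (enum-injective X₁ eq₁) (enum-injective X₂ eq₂)

    -- All three pairs lie in one block, and the coordinate in which `b` or `c` departs from `a` is
    -- its third point. If the same coordinate changes, the pairs agree; if different ones do, the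
    -- third point would lie in both `X₁` and `X₂`.
    R-functional : ∀ {a b c} → R a b → R a c → b ≡ c
    R-functional {a} {b} {c} r s = conclude (R.share r) (R.share s)
      where
      open R r

      block-≡ : R.block s ≡ block
      block-≡ = pair-unique (pt₁ a) (pt₂ a) (pt₁≢pt₂ a a) _ _
        (R.isBlock s) (R.∈₁ s) (R.∈₂ s) isBlock ∈₁ ∈₂

      c₁∈ : pt₁ c ∈ block
      c₁∈ = subst (pt₁ c ∈_) block-≡ (R.∈₁′ s)

      c₂∈ : pt₂ c ∈ block
      c₂∈ = subst (pt₂ c ∈_) block-≡ (R.∈₂′ s)

      third-unique : ∀ {z w} → z ∈ block → w ∈ block → pt₁ a ≢ z → pt₂ a ≢ z →
        pt₁ a ≢ w → pt₂ a ≢ w → z ≡ w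
      third-unique z∈ w∈ a₁≢z a₂≢z a₁≢w a₂≢w
        with ∣p∣≡3⇒p⊆triple block (block-size _ isBlock) ∈₁ ∈₂ z∈ (pt₁≢pt₂ a a) a₁≢z a₂≢z w∈
      ... | inj₁ w≡a₁        = contradiction (sym w≡a₁) a₁≢w
      ... | inj₂ (inj₁ w≡a₂) = contradiction (sym w≡a₂) a₂≢w
      ... | inj₂ (inj₂ w≡z)  = sym w≡z

      conclude : _ → _ → b ≡ c
      conclude (inj₁ (b₁ , b₂)) (inj₁ (c₁ , c₂)) = Pair-≡
        (third-unique ∈₁′ c₁∈ b₁ (pt₁≢pt₂ b a ∘ sym) c₁ (pt₁≢pt₂ c a ∘ sym)) (trans (sym b₂) c₂)
      conclude (inj₂ (b₁ , b₂)) (inj₂ (c₁ , c₂)) = Pair-≡ (trans (sym b₁) c₁)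
        (third-unique ∈₂′ c₂∈ (pt₁≢pt₂ a b) b₂ (pt₁≢pt₂ a c) c₂)
      conclude (inj₁ (b₁ , b₂)) (inj₂ (c₁ , c₂)) = contradiction
        (third-unique ∈₁′ c₂∈ b₁ (pt₁≢pt₂ b a ∘ sym) (pt₁≢pt₂ a c) c₂) (pt₁≢pt₂ b c)
      conclude (inj₂ (b₁ , b₂)) (inj₁ (c₁ , c₂)) = contradiction
        (third-unique c₁∈ ∈₂′ c₁ (pt₁≢pt₂ c a ∘ sym) (pt₁≢pt₂ a b) b₂) (pt₁≢pt₂ c b)

    -- The third point of the block is not in `X₃`, so it can replace the coordinate of `a` that
    -- comes from its own set.
    mate : ∀ a → ∃ (R a)
    mate a@(i , j) with pair-covered (pt₁ a) (pt₂ a) (pt₁≢pt₂ a a)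
    ... | B , 𝓑B , a₁∈ , a₂∈ with ∣p∣≡3⇒third B (block-size B 𝓑B) a₁∈ a₂∈ (pt₁≢pt₂ a a)
    ...   | z , z∈ , z≢a₁ , z≢a₂ with cover z
    ...     | inj₁ z∈₁ = (rank z∈₁ , j) , record
      { block = B ; isBlock = 𝓑B ; ∈₁ = a₁∈ ; ∈₂ = a₂∈ ; ∈₁′ = subst (_∈ B) (sym (enum-rank z∈₁)) z∈ ; ∈₂′ = a₂∈
      ; share = inj₁ ((λ eq → z≢a₁ (sym (trans eq (enum-rank z∈₁)))) , refl) }
    ...     | inj₂ (inj₁ z∈₂) = (i , rank z∈₂) , record
      { block = B ; isBlock = 𝓑B ; ∈₁ = a₁∈ ; ∈₂ = a₂∈ ; ∈₁′ = a₁∈ ; ∈₂′ = subst (_∈ B) (sym (enum-rank z∈₂)) z∈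
      ; share = inj₂ (refl , (λ eq → z≢a₂ (sym (trans eq (enum-rank z∈₂))))) }
    ...     | inj₂ (inj₂ z∈₃) = contradiction (enum-∈ X₁ i , enum-∈ X₂ j , z∈₃) (no-transversal 𝓑B a₁∈ a₂∈ z∈)

-- Steiner quasigroups and the triple systems they define

record SteinerQuasigroup (V : Set) : Set where
  field
    _∙_        : V → V → V
    idem       : ∀ x → x ∙ x ≡ x
    comm       : ∀ x y → x ∙ y ≡ y ∙ x
    involutive : ∀ x y → x ∙ (x ∙ y) ≡ y

  -- Left translation by `x` is an involution that fixes `x`, so it sends no other point to `x`.
  ∙≢ˡ : ∀ {x y} → x ≢ y → x ≢ x ∙ y
  ∙≢ˡ {x} {y} x≢y x≡xy = x≢y (trans (sym (idem x)) (trans (cong (x ∙_) x≡xy) (involutive x y)))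

  ∙≢ʳ : ∀ {x y} → x ≢ y → y ≢ x ∙ y
  ∙≢ʳ {x} {y} x≢y y≡xy = ∙≢ˡ (x≢y ∘ sym) (trans y≡xy (comm x y))

transport : ∀ {V W : Set} → V ↔ W → SteinerQuasigroup W → SteinerQuasigroup V
transport bij Q = record
  { _∙_        = λ x y → from (to x ∙ to y)
  ; idem       = λ x → trans (cong from (idem (to x))) (strictlyInverseʳ x)
  ; comm       = λ x y → cong from (comm (to x) (to y))
  ; involutive = λ x y → trans (cong from (trans (cong (to x ∙_) (strictlyInverseˡ _)) (involutive (to x) (to y))))
                               (strictlyInverseʳ y)
  }
  where
  open Inverse bij
  open SteinerQuasigroup Q

module SteinerSystem (Q : SteinerQuasigroup (Fin n)) where
  open SteinerQuasigroup Q

  line : Fin n → Fin n → Subset n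
  line x y = triple x y (x ∙ y)

  𝓛 : Subset n → Set
  𝓛 B = ∃₂ λ x y → x ≢ y × B ≡ line x y

  ∣line∣≡3 : ∀ {x y} → x ≢ y → ∣ line x y ∣ ≡ 3
  ∣line∣≡3 x≢y = ∣triple∣≡3 x≢y (∙≢ˡ x≢y) (∙≢ʳ x≢y)

  -- Any two distinct points of the triple have the remaining one as their product; equal points are
  -- covered by idempotence.
  line-closed : ∀ {x y a b} → a ∈ line x y → b ∈ line x y → a ∙ b ∈ line x y
  line-closed {x} {y} a∈ b∈ = ∈-triple⁺ (go (∈-triple⁻ a∈) (∈-triple⁻ b∈))
    where
    yx∙y : y ∙ (x ∙ y) ≡ x
    yx∙y = trans (cong (y ∙_) (comm x y)) (involutive y x)

    go : ∀ {a b} → a ≡ x ⊎ a ≡ y ⊎ a ≡ x ∙ y → b ≡ x ⊎ b ≡ y ⊎ b ≡ x ∙ y →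
         a ∙ b ≡ x ⊎ a ∙ b ≡ y ⊎ a ∙ b ≡ x ∙ y
    go (inj₁ refl)        (inj₁ refl)        = inj₁ (idem x)
    go (inj₁ refl)        (inj₂ (inj₁ refl)) = inj₂ (inj₂ refl)
    go (inj₁ refl)        (inj₂ (inj₂ refl)) = inj₂ (inj₁ (involutive x y))
    go (inj₂ (inj₁ refl)) (inj₁ refl)        = inj₂ (inj₂ (comm y x))
    go (inj₂ (inj₁ refl)) (inj₂ (inj₁ refl)) = inj₂ (inj₁ (idem y))
    go (inj₂ (inj₁ refl)) (inj₂ (inj₂ refl)) = inj₁ yx∙y
    go (inj₂ (inj₂ refl)) (inj₁ refl)        = inj₂ (inj₁ (trans (comm _ x) (involutive x y)))
    go (inj₂ (inj₂ refl)) (inj₂ (inj₁ refl)) = inj₁ (trans (comm _ y) yx∙y)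
    go (inj₂ (inj₂ refl)) (inj₂ (inj₂ refl)) = inj₂ (inj₂ (idem _))

  line-members : ∀ {B a b c} → 𝓛 B → a ∈ B → b ∈ B → a ≢ b → c ∈ B → c ≡ a ⊎ c ≡ b ⊎ c ≡ a ∙ b
  line-members (x , y , x≢y , refl) a∈ b∈ a≢b =
    ∣p∣≡3⇒p⊆triple (line x y) (∣line∣≡3 x≢y) a∈ b∈ (line-closed {x} {y} a∈ b∈) a≢b (∙≢ˡ a≢b) (∙≢ʳ a≢b)

  -- Any two distinct points generate their block: closure puts the product in it, and size three
  -- leaves room for nothing else.
  line-unique : ∀ {B a b} → 𝓛 B → a ∈ B → b ∈ B → a ≢ b → B ≡ line a b
  line-unique {B} {a} {b} B∈𝓛@(x , y , _ , refl) a∈ b∈ a≢b =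
    ⊆-antisym (∈-triple⁺ ∘ line-members B∈𝓛 a∈ b∈ a≢b) (back ∘ ∈-triple⁻)
    where
    back : ∀ {c} → c ≡ a ⊎ c ≡ b ⊎ c ≡ a ∙ b → c ∈ B
    back (inj₁ refl)        = a∈
    back (inj₂ (inj₁ refl)) = b∈
    back (inj₂ (inj₂ refl)) = line-closed {x} {y} a∈ b∈

  isSTS : IsSTS n 𝓛
  isSTS = record
    { block-size   = λ { _ (_ , _ , x≢y , refl) → ∣line∣≡3 x≢y }
    ; pair-covered = λ x y x≢y → line x y , (x , y , x≢y , refl) , ∈-triple⁺ (inj₁ refl) , ∈-triple⁺ (inj₂ (inj₁ refl))
    ; pair-unique  = λ _ _ x≢y _ _ B∈𝓛 x∈B y∈B B′∈𝓛 x∈B′ y∈B′ →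
        trans (line-unique B∈𝓛 x∈B y∈B x≢y) (sym (line-unique B′∈𝓛 x∈B′ y∈B′ x≢y))
    }

-- Reading off the size of a subset

∣p∣≡1⇒Nonempty : (p : Subset n) → ∣ p ∣ ≡ 1 → Nonempty p
∣p∣≡1⇒Nonempty p ∣p∣≡1 = let i = subst Fin (sym ∣p∣≡1) 0F in enum p i , enum-∈ p i

-- `enum` and `rank` turn `e` into a bijection between `Fin ∣ p ∣` and `A`, and finite types in
-- bijection have equal sizes.
bijection⇒∣p∣≡m : ∀ {A : Set} (p : Subset n) → Fin m ↔ A → (e : A → Fin n) → Injective _≡_ _≡_ e →
  (∀ a → e a ∈ p) → (∀ {x} → x ∈ p → ∃ λ a → e a ≡ x) → ∣ p ∣ ≡ m
bijection⇒∣p∣≡m p bij e e-inj e∈p onto = ↔⇒≡ (↔-trans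
  (mk↔ₛ′ (λ i → proj₁ (onto (enum-∈ p i))) (λ a → rank (e∈p a))
    (λ a → e-inj (trans (proj₂ (onto (enum-∈ p _))) (enum-rank (e∈p a))))
    (λ i → enum-injective p (trans (enum-rank (e∈p _)) (proj₂ (onto (enum-∈ p i))))))
  (↔-sym bij))

-- Addition and subtraction modulo N

module _ {N : ℕ} .{{_ : NonZero N}} where

  _⊕_ : Fin N → Fin N → Fin N
  x ⊕ y = (toℕ x + toℕ y) mod N

  -- Since `toℕ y < N`, the difference `N ∸ toℕ y` is exact, whereas `toℕ x ∸ toℕ y` could be cut
  -- off at zero.
  _⊖_ : Fin N → Fin N → Fin N
  x ⊖ y = (toℕ x + (N ∸ toℕ y)) mod N

  toℕ-mod : ∀ a → toℕ (a mod N) ≡ a % N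
  toℕ-mod a = toℕ-fromℕ< (m%n<n a N)

  toℕ-% : ∀ (x : Fin N) → toℕ x % N ≡ toℕ x
  toℕ-% x = m<n⇒m%n≡m (toℕ<n x)

  [a%N+b]%N : ∀ a b → (a % N + b) % N ≡ (a + b) % N
  [a%N+b]%N a b = trans (%-distribˡ-+ (a % N) b N)
    (trans (cong (λ t → (t + b % N) % N) (m%n%n≡m%n a N)) (sym (%-distribˡ-+ a b N)))

  -- The common core of both cancellation laws: the two summands overshoot `x` by exactly one full
  -- turn, and reducing early does no harm.
  mod-cancel : ∀ (x : Fin N) {a b} → a + b ≡ toℕ x + N → ((toℕ (a mod N) + b) mod N) ≡ x
  mod-cancel x {a} {b} eq = toℕ-injective (begin
    toℕ ((toℕ (a mod N) + b) mod N) ≡⟨ toℕ-mod _ ⟩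
    (toℕ (a mod N) + b) % N         ≡⟨ cong (λ t → (t + b) % N) (toℕ-mod a) ⟩
    (a % N + b) % N                 ≡⟨ [a%N+b]%N a b ⟩
    (a + b) % N                     ≡⟨ cong (_% N) eq ⟩
    (toℕ x + N) % N                 ≡⟨ [m+n]%n≡m%n (toℕ x) N ⟩
    toℕ x % N                       ≡⟨ toℕ-% x ⟩
    toℕ x                           ∎)
    where open ≡-Reasoning

  ⊕-comm : ∀ x y → x ⊕ y ≡ y ⊕ x
  ⊕-comm x y = cong (_mod N) (+-comm (toℕ x) (toℕ y))

  ⊕-⊖ : ∀ x y → (x ⊕ y) ⊖ x ≡ y
  ⊕-⊖ x y = mod-cancel y (begin
    toℕ x + toℕ y + (N ∸ toℕ x)   ≡⟨ cong (_+ (N ∸ toℕ x)) (+-comm (toℕ x) (toℕ y)) ⟩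
    toℕ y + toℕ x + (N ∸ toℕ x)   ≡⟨ +-assoc (toℕ y) (toℕ x) _ ⟩
    toℕ y + (toℕ x + (N ∸ toℕ x)) ≡⟨ cong (toℕ y +_) (m+[n∸m]≡n (<⇒≤ (toℕ<n x))) ⟩
    toℕ y + N                     ∎)
    where open ≡-Reasoning

  ⊖-⊕ : ∀ x y → x ⊕ (y ⊖ x) ≡ y
  ⊖-⊕ x y = trans (⊕-comm x (y ⊖ x)) (mod-cancel y (begin
    toℕ y + (N ∸ toℕ x) + toℕ x   ≡⟨ +-assoc (toℕ y) _ (toℕ x) ⟩
    toℕ y + (N ∸ toℕ x + toℕ x)   ≡⟨ cong (toℕ y +_) (trans (+-comm _ (toℕ x)) (m+[n∸m]≡n (<⇒≤ (toℕ<n x)))) ⟩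
    toℕ y + N                     ∎))
    where open ≡-Reasoning

-- Commutative quasigroups, and a half-idempotent one of order 2k

record CommutativeQuasigroup (A : Set) : Set where
  field
    _·_   : A → A → A
    _\\_  : A → A → A
    comm  : ∀ x y → x · y ≡ y · x
    \\-·  : ∀ x y → x \\ (x · y) ≡ y
    ·-\\  : ∀ x y → x · (x \\ y) ≡ y

  \\-\\ : ∀ x z → (x \\ z) \\ z ≡ x
  \\-\\ x z = trans (cong ((x \\ z) \\_) (sym (trans (comm (x \\ z) x) (·-\\ x z)))) (\\-· (x \\ z) x)

-- The cyclic group of order 2k with (δ , i) standing for δ k + i as a factor, but for 2 i + δ as a product.
module HalfIdempotent (k : ℕ) .{{_ : NonZero k}} where

  private instance
    2k≢0 : NonZero (2 * k)
    2k≢0 = m*n≢0 2 k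

  private
    factor : Fin 2 × Fin k → Fin (2 * k)
    factor (δ , i) = combine δ i

    factor⁻¹ : Fin (2 * k) → Fin 2 × Fin k
    factor⁻¹ = remQuot k

    product : Fin (2 * k) → Fin 2 × Fin k
    product z = swap (remQuot 2 (cast (*-comm 2 k) z))

    product⁻¹ : Fin 2 × Fin k → Fin (2 * k)
    product⁻¹ (δ , i) = cast (*-comm k 2) (combine i δ)

    product-product⁻¹ : ∀ h → product (product⁻¹ h) ≡ h
    product-product⁻¹ (δ , i) = cong swap (trans
      (cong (remQuot 2) (trans (cast-trans (*-comm k 2) (*-comm 2 k) _) (cast-is-id refl _)))
      (remQuot-combine i δ))

    product⁻¹-product : ∀ z → product⁻¹ (product z) ≡ z
    product⁻¹-product z = trans (cong (cast (*-comm k 2)) (combine-remQuot {k} 2 _))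
      (trans (cast-trans (*-comm 2 k) (*-comm k 2) z) (cast-is-id refl z))

  quasigroup : CommutativeQuasigroup (Fin 2 × Fin k)
  quasigroup = record
    { _·_  = λ x y → product (factor x ⊕ factor y)
    ; _\\_ = λ x z → factor⁻¹ (product⁻¹ z ⊖ factor x)
    ; comm = λ x y → cong product (⊕-comm (factor x) (factor y))
    ; \\-· = λ x (δ , i) → trans
        (cong factor⁻¹ (trans (cong (_⊖ factor x) (product⁻¹-product _)) (⊕-⊖ (factor x) (factor (δ , i)))))
        (remQuot-combine δ i)
    ; ·-\\ = λ x z → trans
        (cong product (trans (cong (factor x ⊕_) (combine-remQuot {2} k _)) (⊖-⊕ (factor x) (product⁻¹ z))))
        (product-product⁻¹ z)
    }

  open CommutativeQuasigroup quasigroup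

  -- Doubling δ k + i gives 2 i + δ (2 k), which is 2 i modulo 2k, and 2 i as a product stands for
  -- `(0F , i)`.
  half-idem : ∀ δ i → (δ , i) · (δ , i) ≡ (0F , i)
  half-idem δ i = trans (cong product (toℕ-injective (begin
    toℕ (factor (δ , i) ⊕ factor (δ , i))   ≡⟨ toℕ-mod _ ⟩
    (toℕ (combine δ i) + toℕ (combine δ i)) % (2 * k)
      ≡⟨ cong (λ t → (t + t) % (2 * k)) (toℕ-combine δ i) ⟩
    ((k * toℕ δ + toℕ i) + (k * toℕ δ + toℕ i)) % (2 * k)
      ≡⟨ cong (_% (2 * k)) (rearrange k (toℕ δ) (toℕ i)) ⟩
    (2 * toℕ i + 0 + toℕ δ * (2 * k)) % (2 * k)  ≡⟨ [m+kn]%n≡m%n _ (toℕ δ) (2 * k) ⟩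
    (2 * toℕ i + 0) % (2 * k)               ≡⟨ cong (_% (2 * k)) toℕ-2i ⟨
    toℕ (product⁻¹ (0F , i)) % (2 * k)      ≡⟨ toℕ-% (product⁻¹ (0F , i)) ⟩
    toℕ (product⁻¹ (0F , i))                ∎))) (product-product⁻¹ (0F , i))
    where
    open ≡-Reasoning

    -- The summand 0 matches the form in which `toℕ-combine i 0F` delivers the value.
    rearrange : ∀ k δ i → (k * δ + i) + (k * δ + i) ≡ 2 * i + 0 + δ * (2 * k)
    rearrange = solve-∀

    toℕ-2i : toℕ (product⁻¹ (0F , i)) ≡ 2 * toℕ i + 0
    toℕ-2i = trans (toℕ-cast (*-comm k 2) (combine i 0F)) (toℕ-combine i 0F)

-- Adjoining three points along a 3-edge-coloured cubic graph

line₃ : SteinerQuasigroup (Fin 3)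
line₃ = record
  { _∙_        = _∙_
  ; idem       = from-yes (all? λ x → x ∙ x ≟ x)
  ; comm       = from-yes (all? λ x → all? λ y → x ∙ y ≟ y ∙ x)
  ; involutive = from-yes (all? λ x → all? λ y → x ∙ (x ∙ y) ≟ y)
  }
  where
  _∙_ : Fin 3 → Fin 3 → Fin 3
  0F ∙ 0F = 0F
  0F ∙ 1F = 2F
  0F ∙ 2F = 1F
  1F ∙ 0F = 2F
  1F ∙ 1F = 1F
  1F ∙ 2F = 0F
  2F ∙ 0F = 1F
  2F ∙ 1F = 0F
  2F ∙ 2F = 2F

-- The closed neighbourhood of `v` in the graph whose edge of colour `c` at `v` leads to `mate c v`.
Near : ∀ {W : Set} → (Fin 3 → W → W) → W → W → Set
Near mate v w = w ≡ v ⊎ ∃ λ c → w ≡ mate c v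

record Matchings (W : Set) (_∙_ : W → W → W) : Set where
  field
    mate           : Fin 3 → W → W
    mate-invol     : ∀ c v → mate c (mate c v) ≡ v
    mate-injective : ∀ v {c d} → mate c v ≡ mate d v → c ≡ d
    mate≢          : ∀ c v → mate c v ≢ v
    near-square : ∀ v → Near mate v (v ∙ v)
    near-mate   : ∀ v c → Near mate v (v ∙ mate c v)

-- The triples {v , w , v ∙ w} with w not near v, the triples {v , mate c v , ∞ c}, and {∞ 0 , ∞ 1 , ∞ 2}.
module Extension {W : Set} (_≟ʷ_ : DecidableEquality W) (_∙_ : W → W → W)
  (∙-comm : ∀ v w → v ∙ w ≡ w ∙ v) (∙-invol : ∀ v w → v ∙ (v ∙ w) ≡ w)
  (matchings : Matchings W _∙_) where
  open Matchings matchings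

  near-∙ : ∀ {v w} → Near mate v w → Near mate v (v ∙ w)
  near-∙ {v} (inj₁ refl)       = near-square v
  near-∙ {v} (inj₂ (c , refl)) = near-mate v c

  near-sym : ∀ {v w} → Near mate v w → Near mate w v
  near-sym     (inj₁ refl)       = inj₁ refl
  near-sym {v} (inj₂ (c , refl)) = inj₂ (c , sym (mate-invol c v))

  near? : ∀ v w → Near mate v w ⊎ ¬ Near mate v w
  near? v w with w ≟ʷ v | any? (λ c → w ≟ʷ mate c v)
  ... | yes w≡v | _      = inj₁ (inj₁ w≡v)
  ... | no  _   | yes w≡ = inj₁ (inj₂ w≡)
  ... | no  w≢v | no  w≢ = inj₂ [ w≢v , w≢ ]′

  V : Set
  V = W ⊎ Fin 3

  join : ∀ {v w} → Near mate v w ⊎ ¬ Near mate v w → V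
  join {v}     (inj₁ (inj₁ _))       = inj₁ v
  join         (inj₁ (inj₂ (c , _))) = inj₂ c
  join {v} {w} (inj₂ _)              = inj₁ (v ∙ w)

  _◦_ : V → V → V
  inj₁ v ◦ inj₁ w = join (near? v w)
  inj₁ v ◦ inj₂ c = inj₁ (mate c v)
  inj₂ c ◦ inj₁ v = inj₁ (mate c v)
  inj₂ c ◦ inj₂ d = inj₂ (SteinerQuasigroup._∙_ line₃ c d)

  ◦-self : ∀ v → inj₁ v ◦ inj₁ v ≡ inj₁ v
  ◦-self v with near? v v
  ... | inj₁ (inj₁ _)        = refl
  ... | inj₁ (inj₂ (c , eq)) = contradiction (sym eq) (mate≢ c v)
  ... | inj₂ far             = contradiction (inj₁ refl) far

  ◦-mate : ∀ v c → inj₁ v ◦ inj₁ (mate c v) ≡ inj₂ c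
  ◦-mate v c with near? v (mate c v)
  ... | inj₁ (inj₁ eq)       = contradiction eq (mate≢ c v)
  ... | inj₁ (inj₂ (d , eq)) = cong inj₂ (sym (mate-injective v eq))
  ... | inj₂ far             = contradiction (inj₂ (c , refl)) far

  ◦-far : ∀ v w → ¬ Near mate v w → inj₁ v ◦ inj₁ w ≡ inj₁ (v ∙ w)
  ◦-far v w far with near? v w
  ... | inj₁ near = contradiction near far
  ... | inj₂ _    = refl

  ◦-comm : ∀ x y → x ◦ y ≡ y ◦ x
  ◦-comm (inj₁ v) (inj₁ w) with near? v w
  ... | inj₁ (inj₁ refl)       = sym (◦-self v)
  ... | inj₁ (inj₂ (c , refl)) =
    sym (trans (cong (λ u → inj₁ (mate c v) ◦ inj₁ u) (sym (mate-invol c v))) (◦-mate (mate c v) c))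
  ... | inj₂ far               = trans (cong inj₁ (∙-comm v w)) (sym (◦-far w v (far ∘ near-sym)))
  ◦-comm (inj₁ v) (inj₂ c) = refl
  ◦-comm (inj₂ c) (inj₁ v) = refl
  ◦-comm (inj₂ c) (inj₂ d) = cong inj₂ (SteinerQuasigroup.comm line₃ c d)

  ◦-invol : ∀ x y → x ◦ (x ◦ y) ≡ y
  ◦-invol (inj₁ v) (inj₁ w) with near? v w
  ... | inj₁ (inj₁ refl)       = ◦-self v
  ... | inj₁ (inj₂ (c , refl)) = refl
  ... | inj₂ far               = trans
    -- If `v ∙ w` were near `v`, so would be `v ∙ (v ∙ w)`, which is `w`.
    (◦-far v (v ∙ w) (λ near → far (subst (Near mate v) (∙-invol v w) (near-∙ near))))
    (cong inj₁ (∙-invol v w))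
  ◦-invol (inj₁ v) (inj₂ c) = ◦-mate v c
  ◦-invol (inj₂ c) (inj₁ v) = cong inj₁ (mate-invol c v)
  ◦-invol (inj₂ c) (inj₂ d) = cong inj₂ (SteinerQuasigroup.involutive line₃ c d)

  ◦-idem : ∀ x → x ◦ x ≡ x
  ◦-idem (inj₁ v) = ◦-self v
  ◦-idem (inj₂ c) = cong inj₂ (SteinerQuasigroup.idem line₃ c)

  steiner : SteinerQuasigroup V
  steiner = record { _∙_ = _◦_ ; idem = ◦-idem ; comm = ◦-comm ; involutive = ◦-invol }

  -- Within `W` the extension alters products only to make points idempotent. This carries the
  -- absence of crossings over from `_∙_`.
  ◦-inj₁ : ∀ v w u → inj₁ v ◦ inj₁ w ≡ inj₁ u → u ≡ v ⊎ u ≡ v ∙ w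
  ◦-inj₁ v w u eq with near? v w
  ◦-inj₁ v w u refl | inj₁ (inj₁ _) = inj₁ refl
  ◦-inj₁ v w u refl | inj₂ _        = inj₂ refl

-- Arithmetic modulo 3 and the product on three layers

next : Fin 3 → Fin 3
next 0F = 1F
next 1F = 2F
next 2F = 0F

next³ : ∀ j → next (next (next j)) ≡ j
next³ = from-yes (all? λ j → next (next (next j)) ≟ j)

_+₃_ : Fin 3 → Fin 3 → Fin 3
j +₃ 0F = j
j +₃ 1F = next j
j +₃ 2F = next (next j)

_-₃_ : Fin 3 → Fin 3 → Fin 3
j -₃ 0F = j
j -₃ 1F = next (next j)
j -₃ 2F = next j

+₃-comm : ∀ a b → a +₃ b ≡ b +₃ a
+₃-comm = from-yes (all? λ a → all? λ b → a +₃ b ≟ b +₃ a)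

+₃-cancel : ∀ a b → (a +₃ b) -₃ a ≡ b
+₃-cancel = from-yes (all? λ a → all? λ b → (a +₃ b) -₃ a ≟ b)

-₃-cancel : ∀ a s → a +₃ (s -₃ a) ≡ s
-₃-cancel = from-yes (all? λ a → all? λ s → a +₃ (s -₃ a) ≟ s)

module ThreeLayers {Q : Set} (quasigroup : CommutativeQuasigroup Q) where
  open CommutativeQuasigroup quasigroup

  -- The first three clauses define the triples; total symmetry forces the other six, which recover
  -- a missing factor. Points of layers `j` and `next j` have their product back in layer `j`, so no
  -- triple meets all three layers.
  _∙_ : Fin 3 × Q → Fin 3 × Q → Fin 3 × Q
  (0F , x) ∙ (0F , y) = 1F , x · y
  (1F , x) ∙ (1F , y) = 2F , x · y
  (2F , x) ∙ (2F , y) = 0F , x · y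
  (0F , x) ∙ (1F , z) = 0F , x \\ z
  (1F , x) ∙ (2F , z) = 1F , x \\ z
  (2F , x) ∙ (0F , z) = 2F , x \\ z
  (1F , z) ∙ (0F , x) = 0F , x \\ z
  (2F , z) ∙ (1F , x) = 1F , x \\ z
  (0F , z) ∙ (2F , x) = 2F , x \\ z

  ∙-comm : ∀ v w → v ∙ w ≡ w ∙ v
  ∙-comm (0F , x) (0F , y) = cong (1F ,_) (comm x y)
  ∙-comm (1F , x) (1F , y) = cong (2F ,_) (comm x y)
  ∙-comm (2F , x) (2F , y) = cong (0F ,_) (comm x y)
  ∙-comm (0F , x) (1F , z) = refl
  ∙-comm (1F , x) (2F , z) = refl
  ∙-comm (2F , x) (0F , z) = refl
  ∙-comm (1F , z) (0F , x) = refl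
  ∙-comm (2F , z) (1F , x) = refl
  ∙-comm (0F , z) (2F , x) = refl

  ∙-invol : ∀ v w → v ∙ (v ∙ w) ≡ w
  ∙-invol (0F , x) (0F , y) = cong (0F ,_) (\\-· x y)
  ∙-invol (1F , x) (1F , y) = cong (1F ,_) (\\-· x y)
  ∙-invol (2F , x) (2F , y) = cong (2F ,_) (\\-· x y)
  ∙-invol (0F , x) (1F , z) = cong (1F ,_) (·-\\ x z)
  ∙-invol (1F , x) (2F , z) = cong (2F ,_) (·-\\ x z)
  ∙-invol (2F , x) (0F , z) = cong (0F ,_) (·-\\ x z)
  ∙-invol (1F , z) (0F , x) = cong (0F ,_) (\\-\\ x z)
  ∙-invol (2F , z) (1F , x) = cong (1F ,_) (\\-\\ x z)
  ∙-invol (0F , z) (2F , x) = cong (2F ,_) (\\-\\ x z)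

  -- `_∙_` does not reduce while `j` is a variable; this lets later computations treat all layers at
  -- once.
  ∙-layer : ∀ j x y → (j , x) ∙ (j , y) ≡ (next j , x · y)
  ∙-layer 0F x y = refl
  ∙-layer 1F x y = refl
  ∙-layer 2F x y = refl

-- The three layers as a cross-free set

module LayeredSystem {Q : Set} (labels : Fin m ↔ Q) (points : Fin n ↔ ((Fin 3 × Q) ⊎ Fin 3))
  (steiner : SteinerQuasigroup ((Fin 3 × Q) ⊎ Fin 3))
  (no-crossing : ∀ x y z → SteinerQuasigroup._∙_ steiner (inj₁ (0F , x)) (inj₁ (1F , y)) ≢ inj₁ (2F , z)) where

  V : Set
  V = (Fin 3 × Q) ⊎ Fin 3

  open Inverse points
  open SteinerQuasigroup steiner using () renaming (_∙_ to _◦_)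
  open SteinerSystem (transport points steiner) public using (𝓛; isSTS; line-members)

  inLayer : Fin 3 → V → Bool
  inLayer j (inj₁ (l , _)) = does (l ≟ j)
  inLayer j (inj₂ _)       = false

  layer : Fin 3 → Subset n
  layer j = tabulate (inLayer j ∘ to)

  point : Fin 3 → Q → Fin n
  point j x = from (inj₁ (j , x))

  inLayer⁻ : ∀ j v → inLayer j v ≡ true → ∃ λ x → inj₁ (j , x) ≡ v
  inLayer⁻ j (inj₁ (l , x)) eq with l ≟ j
  ... | yes refl = x , refl
  inLayer⁻ j (inj₁ (l , x)) () | no _

  ∈-layer⁻ : ∀ j {p} → p ∈ layer j → ∃ λ x → point j x ≡ p
  ∈-layer⁻ j {p} p∈ =
    let (x , eq) = inLayer⁻ j (to p) (trans (sym (lookup∘tabulate _ p)) ([]=⇒lookup p∈))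
    in x , trans (cong from eq) (strictlyInverseʳ p)

  ∈-layer⁺ : ∀ j x → point j x ∈ layer j
  ∈-layer⁺ j x = lookup⇒[]= _ _ (trans (lookup∘tabulate _ (point j x))
    (trans (cong (inLayer j) (strictlyInverseˡ _)) (dec-true (j ≟ j) refl)))

  point-injective : ∀ {j l x y} → point j x ≡ point l y → (j , x) ≡ (l , y)
  point-injective eq = inj₁-injective (trans (sym (strictlyInverseˡ _)) (trans (cong to eq) (strictlyInverseˡ _)))

  ∣layer∣≡m : ∀ j → ∣ layer j ∣ ≡ m
  ∣layer∣≡m j = bijection⇒∣p∣≡m (layer j) labels (point j)
    (λ eq → cong proj₂ (point-injective eq)) (∈-layer⁺ j) (∈-layer⁻ j)

  layers-disjoint : ∀ {j l} → j ≢ l → Empty (layer j ∩ layer l)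
  layers-disjoint {j} {l} j≢l (p , p∈) =
    let (p∈j , p∈l) = x∈p∩q⁻ (layer j) (layer l) p∈
        (x , px≡p)  = ∈-layer⁻ j p∈j
        (y , py≡p)  = ∈-layer⁻ l p∈l
    in j≢l (cong proj₁ (point-injective (trans px≡p (sym py≡p))))

  hasCrossFree : HasCrossFree n 𝓛 m
  hasCrossFree = layer 0F , layer 1F , layer 2F , record
    { size₁ = ∣layer∣≡m 0F ; size₂ = ∣layer∣≡m 1F ; size₃ = ∣layer∣≡m 2F
    ; disj₁₂ = layers-disjoint (λ ()) ; disj₁₃ = layers-disjoint (λ ()) ; disj₂₃ = layers-disjoint (λ ())
    ; no-cross = λ L L∈𝓛 (one₀ , one₁ , one₂) → crossing L L∈𝓛 (meet L 0F one₀) (meet L 1F one₁) (meet L 2F one₂)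
    }
    where
    meet : ∀ L j → ∣ L ∩ layer j ∣ ≡ 1 → ∃ λ x → point j x ∈ L
    meet L j one with ∣p∣≡1⇒Nonempty (L ∩ layer j) one
    ... | p , p∈ with x∈p∩q⁻ L (layer j) p∈
    ...   | p∈L , p∈j with ∈-layer⁻ j p∈j
    ...     | x , refl = x , p∈L

    layers-differ : ∀ {j l x y} → j ≢ l → point j x ≢ point l y
    layers-differ j≢l eq = j≢l (cong proj₁ (point-injective eq))

    -- Points of `L` in layers 0, 1 and 2 are distinct, so the last is the product of the first two,
    -- against `no-crossing`.
    crossing : ∀ L → 𝓛 L → (∃ λ x → point 0F x ∈ L) → (∃ λ y → point 1F y ∈ L) → ¬ (∃ λ z → point 2F z ∈ L)
    crossing L L∈𝓛 (x , x∈) (y , y∈) (z , z∈) with line-members L∈𝓛 x∈ y∈ (layers-differ λ ()) z∈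
    ... | inj₁ eq        = layers-differ (λ ()) eq
    ... | inj₂ (inj₁ eq) = layers-differ (λ ()) eq
    ... | inj₂ (inj₂ eq) = no-crossing x y z (begin
      inj₁ (0F , x) ◦ inj₁ (1F , y)             ≡⟨ cong₂ _◦_ (strictlyInverseˡ _) (strictlyInverseˡ _) ⟨
      to (point 0F x) ◦ to (point 1F y)         ≡⟨ strictlyInverseˡ _ ⟨
      to (from (to (point 0F x) ◦ to (point 1F y))) ≡⟨ cong to eq ⟨
      to (point 2F z)                           ≡⟨ strictlyInverseˡ _ ⟩
      inj₁ (2F , z)                             ∎)
      where open ≡-Reasoning

-- The quasigroup of order 6k and its cubic graph

module SixClasses (k : ℕ) .{{_ : NonZero k}} where
  open HalfIdempotent k using (half-idem) renaming (quasigroup to half)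
  module H = CommutativeQuasigroup half

  Q : Set
  Q = Fin 3 × (Fin 2 × Fin k)

  -- Six classes of `k` labels each. The products that shape the graph carry the index `i` along, so
  -- the graph is described by classes alone.
  pattern A i = 0F , 0F , i
  pattern B i = 1F , 0F , i
  pattern C i = 2F , 0F , i
  pattern D i = 0F , 1F , i
  pattern E i = 1F , 1F , i
  pattern F i = 2F , 1F , i

  flip : Fin 2 × Fin k → Fin 2 × Fin k
  flip (0F , i) = 1F , i
  flip (1F , i) = 0F , i

  -- The flip separates A i · B i = E i from C i · C i = F i · F i = D i. Thus every label is the value of 0 or 2
  -- of the products x · x, A i · B i, B i · A i, as needed for the graph to be cubic.
  twist : Fin 3 → Fin 3 → Fin 2 × Fin k → Fin 2 × Fin k
  twist 0F 1F h = flip h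
  twist 1F 0F h = flip h
  twist _  _  h = h

  flip-flip : ∀ h → flip (flip h) ≡ h
  flip-flip (0F , i) = refl
  flip-flip (1F , i) = refl

  twist-twist : ∀ a b h → twist a b (twist a b h) ≡ h
  twist-twist 0F 0F h = refl
  twist-twist 0F 1F h = flip-flip h
  twist-twist 0F 2F h = refl
  twist-twist 1F 0F h = flip-flip h
  twist-twist 1F 1F h = refl
  twist-twist 1F 2F h = refl
  twist-twist 2F b  h = refl

  twist-comm : ∀ a b h → twist a b h ≡ twist b a h
  twist-comm 0F 0F h = refl
  twist-comm 0F 1F h = refl
  twist-comm 0F 2F h = refl
  twist-comm 1F 0F h = refl
  twist-comm 1F 1F h = refl
  twist-comm 1F 2F h = refl
  twist-comm 2F 0F h = refl
  twist-comm 2F 1F h = refl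
  twist-comm 2F 2F h = refl

  -- Squares under `_⊗_` fall in the classes `A`, `B`, `C`, two classes of factors to each. But
  -- `A i` and `B i` already carry two triangle sides, so the values are moved to `F`, `D`, `C`,
  -- while `E` stays the value of `A i · B i`. Then every vertex has degree three.
  relabel : Q → Q
  relabel (A i) = F i
  relabel (D i) = A i
  relabel (B i) = D i
  relabel (E i) = E i
  relabel (C i) = C i
  relabel (F i) = B i

  relabel⁻¹ : Q → Q
  relabel⁻¹ (F i) = A i
  relabel⁻¹ (A i) = D i
  relabel⁻¹ (D i) = B i
  relabel⁻¹ (E i) = E i
  relabel⁻¹ (C i) = C i
  relabel⁻¹ (B i) = F i

  relabel-relabel⁻¹ : ∀ x → relabel (relabel⁻¹ x) ≡ x
  relabel-relabel⁻¹ (A i) = refl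
  relabel-relabel⁻¹ (B i) = refl
  relabel-relabel⁻¹ (C i) = refl
  relabel-relabel⁻¹ (D i) = refl
  relabel-relabel⁻¹ (E i) = refl
  relabel-relabel⁻¹ (F i) = refl

  relabel⁻¹-relabel : ∀ x → relabel⁻¹ (relabel x) ≡ x
  relabel⁻¹-relabel (A i) = refl
  relabel⁻¹-relabel (B i) = refl
  relabel⁻¹-relabel (C i) = refl
  relabel⁻¹-relabel (D i) = refl
  relabel⁻¹-relabel (E i) = refl
  relabel⁻¹-relabel (F i) = refl

  _⊗_ : Q → Q → Q
  (a , g) ⊗ (b , h) = a +₃ b , twist a b (g H.· h)

  _⊘_ : Q → Q → Q
  (a , g) ⊘ (s , h) = s -₃ a , g H.\\ twist a (s -₃ a) h

  ⊗-comm : ∀ x y → x ⊗ y ≡ y ⊗ x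
  ⊗-comm (a , g) (b , h) = cong₂ _,_ (+₃-comm a b)
    (trans (twist-comm a b _) (cong (twist b a) (H.comm g h)))

  ⊘-⊗ : ∀ x y → x ⊘ (x ⊗ y) ≡ y
  ⊘-⊗ (a , g) (b , h) rewrite +₃-cancel a b | twist-twist a b (g H.· h) = cong (b ,_) (H.\\-· g h)

  ⊗-⊘ : ∀ x y → x ⊗ (x ⊘ y) ≡ y
  ⊗-⊘ (a , g) (s , h) = cong₂ _,_ (-₃-cancel a s)
    (trans (cong (twist a _) (H.·-\\ g _)) (twist-twist a (s -₃ a) h))

  quasigroup : CommutativeQuasigroup Q
  quasigroup = record
    { _·_  = λ x y → relabel (x ⊗ y)
    ; _\\_ = λ x z → x ⊘ relabel⁻¹ z
    ; comm = λ x y → cong relabel (⊗-comm x y)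
    ; \\-· = λ x y → trans (cong (x ⊘_) (relabel⁻¹-relabel _)) (⊘-⊗ x y)
    ; ·-\\ = λ x z → trans (cong relabel (⊗-⊘ x (relabel⁻¹ z))) (relabel-relabel⁻¹ z)
    }

  open CommutativeQuasigroup quasigroup using (_·_)
  open ThreeLayers quasigroup

  W : Set
  W = Fin 3 × Q

  -- The edge colouring as a table. A shift by `1F` follows an edge towards a square or the apex `E`
  -- of a triangle, a shift by `2F` follows it back, and no shift means a side `A`, `B`. Each side
  -- of a triangle has the colour of the square edge that leaves the opposite corner.
  mate : Fin 3 → W → W
  mate 0F (j , A i) = j +₃ 1F , F i
  mate 1F (j , A i) = j +₃ 1F , E i
  mate 2F (j , A i) = j       , B i
  mate 0F (j , B i) = j +₃ 1F , E i
  mate 1F (j , B i) = j +₃ 1F , C i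
  mate 2F (j , B i) = j       , A i
  mate 0F (j , C i) = j +₃ 1F , D i
  mate 1F (j , C i) = j +₃ 2F , B i
  mate 2F (j , C i) = j +₃ 2F , E i
  mate 0F (j , D i) = j +₃ 2F , C i
  mate 1F (j , D i) = j +₃ 2F , F i
  mate 2F (j , D i) = j +₃ 1F , F i
  mate 0F (j , E i) = j +₃ 2F , B i
  mate 1F (j , E i) = j +₃ 2F , A i
  mate 2F (j , E i) = j +₃ 1F , C i
  mate 0F (j , F i) = j +₃ 2F , A i
  mate 1F (j , F i) = j +₃ 1F , D i
  mate 2F (j , F i) = j +₃ 2F , D i

  mate-invol : ∀ c v → mate c (mate c v) ≡ v
  mate-invol 0F (j , A i) = cong (_, A i) (next³ j)
  mate-invol 1F (j , A i) = cong (_, A i) (next³ j)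
  mate-invol 2F (j , A i) = refl
  mate-invol 0F (j , B i) = cong (_, B i) (next³ j)
  mate-invol 1F (j , B i) = cong (_, B i) (next³ j)
  mate-invol 2F (j , B i) = refl
  mate-invol 0F (j , C i) = cong (_, C i) (next³ j)
  mate-invol 1F (j , C i) = cong (_, C i) (next³ j)
  mate-invol 2F (j , C i) = cong (_, C i) (next³ j)
  mate-invol 0F (j , D i) = cong (_, D i) (next³ j)
  mate-invol 1F (j , D i) = cong (_, D i) (next³ j)
  mate-invol 2F (j , D i) = cong (_, D i) (next³ j)
  mate-invol 0F (j , E i) = cong (_, E i) (next³ j)
  mate-invol 1F (j , E i) = cong (_, E i) (next³ j)
  mate-invol 2F (j , E i) = cong (_, E i) (next³ j)
  mate-invol 0F (j , F i) = cong (_, F i) (next³ j)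
  mate-invol 1F (j , F i) = cong (_, F i) (next³ j)
  mate-invol 2F (j , F i) = cong (_, F i) (next³ j)

  -- Forgetting `i` leaves 18 classes, which already tell the ends of edges apart; so distinctness
  -- is decided by exhaustion with `i` symbolic.
  class : W → Fin 3 × Fin 3 × Fin 2
  class (j , a , δ , _) = j , a , δ

  _≟ᶜ_ : DecidableEquality (Fin 3 × Fin 3 × Fin 2)
  _≟ᶜ_ = ×-≡-dec _≟_ (×-≡-dec _≟_ _≟_)

  mate≢ : ∀ c v → mate c v ≢ v
  mate≢ c (j , a , δ , i) eq = classes-differ c j a δ (cong class eq)
    where
    classes-differ : ∀ c j a δ → class (mate c (j , a , δ , i)) ≢ (j , a , δ)
    classes-differ = from-yes (all? λ c → all? λ j → all? λ a → all? λ δ →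
      ¬? (class (mate c (j , a , δ , i)) ≟ᶜ (j , a , δ)))

  mate-injective : ∀ v {c d} → mate c v ≡ mate d v → c ≡ d
  mate-injective (j , a , δ , i) {c} {d} eq = classes-injective j a δ c d (cong class eq)
    where
    classes-injective : ∀ j a δ c d →
      class (mate c (j , a , δ , i)) ≡ class (mate d (j , a , δ , i)) → c ≡ d
    classes-injective = from-yes (all? λ j → all? λ a → all? λ δ → all? λ c → all? λ d →
      (class (mate c (j , a , δ , i)) ≟ᶜ class (mate d (j , a , δ , i))) →-dec (c ≟ d))

  -- The colour of the pair {v , v ∙ v}.
  colour : W → Fin 3
  colour (_ , A _) = 0F
  colour (_ , B _) = 1F
  colour (_ , C _) = 0F
  colour (_ , D _) = 2F
  colour (_ , E _) = 2F
  colour (_ , F _) = 1F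

  aligned : ∀ a b δ i → (a , δ , i) · (b , δ , i) ≡ relabel (a +₃ b , twist a b (0F , i))
  aligned a b δ i = cong (λ h → relabel (a +₃ b , twist a b h)) (half-idem δ i)

  square : ∀ v → v ∙ v ≡ mate (colour v) v
  square v@(j , a , δ , i) = trans (∙-layer j _ _) (trans (cong (next j ,_) (aligned a a δ i)) (diagonal v))
    where
    diagonal : ∀ v → let (j , a , δ , i) = v in
      (next j , relabel (a +₃ a , twist a a (0F , i))) ≡ mate (colour v) v
    diagonal (j , A i) = refl
    diagonal (j , B i) = refl
    diagonal (j , C i) = refl
    diagonal (j , D i) = refl
    diagonal (j , E i) = refl
    diagonal (j , F i) = refl

  triangle : ∀ j i → (j , A i) ∙ (j , B i) ≡ (next j , E i)
  triangle j i = trans (∙-layer j _ _) (cong (next j ,_) (aligned 0F 1F 0F i))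

  -- The triangle with apex `(j , E i)`: its base lies one layer back, which is `next (next j)`.
  triangle′ : ∀ j i → (next (next j) , A i) ∙ (next (next j) , B i) ≡ (j , E i)
  triangle′ j i = trans (triangle (next (next j)) i) (cong (_, E i) (next³ j))

  near-square : ∀ v → Near mate v (v ∙ v)
  near-square v = inj₂ (colour v , square v)

  -- The edge leads from `v` to its own square, so the product returns to `v`.
  near-outgoing : ∀ v c → colour v ≡ c → Near mate v (v ∙ mate c v)
  near-outgoing v _ refl = inj₁ (trans (cong (v ∙_) (sym (square v))) (∙-invol v v))

  -- Here `v` is the square of its mate `w`, so the product is `w` itself.
  near-incoming : ∀ v c → colour (mate c v) ≡ c → Near mate v (v ∙ mate c v)
  near-incoming v c eq = inj₂ (c , trans (∙-comm v w) (trans (cong (w ∙_) (sym w²≡v)) (∙-invol w w)))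
    where
    w = mate c v
    w²≡v : w ∙ w ≡ v
    w²≡v = trans (square w) (trans (cong (λ d → mate d w) eq) (mate-invol c v))

  third-of : ∀ {u v w} → u ∙ v ≡ w → u ∙ w ≡ v
  third-of {u} {v} refl = ∙-invol u v

  swapped : ∀ {u v w} → u ∙ v ≡ w → v ∙ u ≡ w
  swapped {u} {v} eq = trans (∙-comm v u) eq

  -- Each edge goes to a square, comes from one, or is a triangle side. In the last case the product
  -- is the opposite corner, which is the mate of `v` in another colour.
  near-mate : ∀ v c → Near mate v (v ∙ mate c v)
  near-mate v@(j , A i) 0F = near-outgoing v 0F refl
  near-mate v@(j , A i) 1F = inj₂ (2F , third-of (triangle j i))
  near-mate v@(j , A i) 2F = inj₂ (1F , triangle j i)
  near-mate v@(j , B i) 0F = inj₂ (2F , third-of (swapped (triangle j i)))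
  near-mate v@(j , B i) 1F = near-outgoing v 1F refl
  near-mate v@(j , B i) 2F = inj₂ (0F , swapped (triangle j i))
  near-mate v@(j , C i) 0F = near-outgoing v 0F refl
  near-mate v@(j , C i) 1F = near-incoming v 1F refl
  near-mate v@(j , C i) 2F = near-incoming v 2F refl
  near-mate v@(j , D i) 0F = near-incoming v 0F refl
  near-mate v@(j , D i) 1F = near-incoming v 1F refl
  near-mate v@(j , D i) 2F = near-outgoing v 2F refl
  near-mate v@(j , E i) 0F = inj₂ (1F , swapped (third-of (swapped (triangle′ j i))))
  near-mate v@(j , E i) 1F = inj₂ (0F , swapped (third-of (triangle′ j i)))
  near-mate v@(j , E i) 2F = near-outgoing v 2F refl
  near-mate v@(j , F i) 0F = near-incoming v 0F refl
  near-mate v@(j , F i) 1F = near-outgoing v 1F refl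
  near-mate v@(j , F i) 2F = near-incoming v 2F refl

  matchings : Matchings W _∙_
  matchings = record
    { mate = mate ; mate-invol = mate-invol ; mate-injective = mate-injective ; mate≢ = mate≢
    ; near-square = near-square ; near-mate = near-mate }

  _≟ʷ_ : DecidableEquality W
  _≟ʷ_ = ×-≡-dec _≟_ (×-≡-dec _≟_ (×-≡-dec _≟_ _≟_))

  open Extension _≟ʷ_ _∙_ ∙-comm ∙-invol matchings using (V; _◦_; steiner; ◦-inj₁)

  no-crossing : ∀ x y z → inj₁ (0F , x) ◦ inj₁ (1F , y) ≢ inj₁ (2F , z)
  no-crossing x y z eq with ◦-inj₁ (0F , x) (1F , y) (2F , z) eq
  ... | inj₁ ()
  ... | inj₂ ()

  6*k≡ : ∀ k → 3 * (2 * k) ≡ 6 * k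
  6*k≡ = solve-∀

  18*k≡ : ∀ k → 3 * (3 * (2 * k)) ≡ 18 * k
  18*k≡ = solve-∀

  Fin[6k]↔Q : Fin (6 * k) ↔ Q
  Fin[6k]↔Q = subst (λ N → Fin N ↔ Q) (6*k≡ k) (↔-trans *↔× (↔-refl ×-↔ *↔×))

  Fin[18k]↔W : Fin (18 * k) ↔ W
  Fin[18k]↔W = subst (λ N → Fin N ↔ W) (18*k≡ k)
    (↔-trans *↔× (↔-refl ×-↔ ↔-trans *↔× (↔-refl ×-↔ *↔×)))

  points : Fin (18 * k + 3) ↔ V
  points = ↔-trans +↔⊎ (Fin[18k]↔W ⊎-↔ ↔-refl)

  open LayeredSystem Fin[6k]↔Q points steiner no-crossing public using (𝓛; isSTS; hasCrossFree)

-- Parity of 6k + 1 and both halves of the result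

2∤6k+1 : ∀ k → ¬ 2 ∣ 6 * k + 1
2∤6k+1 k 2∣ = 1+n≰n (∣⇒≤ (∣m+n∣m⇒∣n 2∣ (∣m⇒∣m*n k (divides 3 refl))))

theorem4 : (k : ℕ) → 1 ≤ k →
    Σ (Subset (18 * k + 3) → Set)
    (λ 𝓑 → IsSTS (18 * k + 3) 𝓑 × HasCrossFree (18 * k + 3) 𝓑 (6 * k))
    × ((𝓑 : Subset (18 * k + 3) → Set) → IsSTS (18 * k + 3) 𝓑 →
    ¬ HasCrossFree (18 * k + 3) 𝓑 (6 * k + 1))
-- Matching on `suc` supplies the instance `NonZero k` for `SixClasses`.
theorem4 k@(suc _) _ =
  (𝓛 , isSTS , hasCrossFree) ,
  -- Three sets of 6k + 1 points fill all 18k + 3 points, so the partition argument would make 6k +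
  -- 1 even.
  λ 𝓑 sts crossFree → 2∤6k+1 k (crossFree-partition⇒even sts (thirds k) crossFree)
  where
  open SixClasses k

  thirds : ∀ k → 18 * k + 3 ≡ (6 * k + 1) + ((6 * k + 1) + (6 * k + 1))
  thirds = solve-∀
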